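{- Let $n\geq 3$ be a positive integer. Then $$t(n,3,4)\leq \binom{n}{2}-n+1.$$
   Context: All graphs are finite, undirected and simple. Let $G$ be a nontrivial connected graph of order $n$ (i.e. with $n$ vertices). An edge-coloring of $G$ is any assignment of colors to the edges (adjacent edges may receive the same color). A tree $T$ that is a subgraph of $G$ is a rainbow tree if no two edges of $T$ have the same color. For $S\subseteq V(G)$ with $|S|\geq 2$, a rainbow $S$-tree is a rainbow tree $T$ in $G$ with $S\subseteq V(T)$. For a fixed integer $k$ with $2\leq k\leq n$, an edge-coloring of $G$ is a $k$-rainbow coloring if for every $k$-subset $S$ of $V(G)$ there exists a rainbow $S$-tree. The $k$-rainbow index $rx_k(G)$ is the minimum number of colors needed in a $k$-rainbow coloring of $G$. The quantity $t(n,k,\ell)$ denotes the minimum size (number of edges) of a connected graph $G$ of order $n$ with $rx_k(G)\leq \ell$, where $2\leq \ell\leq n-1$ and $2\leq k\leq n$.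
   Formalization: The claim is proved for n ≥ 5 rather than n ≥ 3, since t(n,3,4) is defined only when 4 ≤ n−1; extended to n = 3 it would be false (a connected graph of order 3 has at least 2 edges, the bound is 1). -}

module Defs where

open import Data.Bool.Base using (Bool; T)
open import Data.Bool.Properties using (T?)
open import Data.Fin.Base using (Fin; zero; suc; inject₁; fromℕ)
open import Data.Fin.Properties using (_<?_)
open import Data.Fin.Subset using (Subset; _∈_; _⊆_; Nonempty; ∣_∣)
open import Data.List.Base using (List; length; filter; cartesianProduct; allFin)
open import Data.Nat.Base using (ℕ; _+_; _≤_)
open import Data.Product.Base using (Σ; ∃-syntax; _×_; _,_)
open import Data.Sum.Base using (_⊎_)
open import Function.Definitions using (Injective)
open import Relation.Binary.Construct.Closure.ReflexiveTransitive using (Star)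
open import Relation.Binary.PropositionalEquality.Core using (_≡_)
open import Relation.Nullary.Decidable.Core using (_×-dec_)
open import Relation.Nullary.Negation.Core using (¬_)

record Graph (n : ℕ) : Set where
  field
    adj       : Fin n → Fin n → Bool

  _~_ : Fin n → Fin n → Set
  i ~ j = T (adj i j)

  field
    ~-sym     : ∀ {i j} → i ~ j → j ~ i
    ~-irrefl  : ∀ {i} → ¬ (i ~ i)

open Graph public

-- Each edge {i , j} is listed once, as the pair with i < j.
edges : ∀ {n} → Graph n → List (Fin n × Fin n)
edges {n} G =
  filter (λ (i , j) → (i <? j) ×-dec T? (adj G i j))
         (cartesianProduct (allFin n) (allFin n))

size : ∀ {n} → Graph n → ℕ
size G = length (edges G)

Connected : ∀ {n} → Graph n → Set
Connected {n} G = ∀ (u v : Fin n) → Star (_~_ G) u v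

record Subgraph {n} (G : Graph n) : Set where
  field
    V          : Subset n
    sadj       : Fin n → Fin n → Bool

  _—_ : Fin n → Fin n → Set
  i — j = T (sadj i j)

  field
    —-sym      : ∀ {i j} → i — j → j — i
    —⇒~        : ∀ {i j} → i — j → _~_ G i j
    —⇒endpoint : ∀ {i j} → i — j → i ∈ V

open Subgraph public

-- A cycle of length 3 + k on distinct vertices.
record Cycle {n} (_⟶_ : Fin n → Fin n → Set) : Set where
  field
    k           : ℕ
    vertex      : Fin (3 + k) → Fin n
    distinct    : Injective _≡_ _≡_ vertex
    consecutive : ∀ (i : Fin (2 + k)) → vertex (inject₁ i) ⟶ vertex (suc i)
    closing     : vertex (fromℕ (2 + k)) ⟶ vertex zero

record IsTree {n} {G : Graph n} (H : Subgraph G) : Set where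
  field
    nonempty  : Nonempty (V H)
    connected : ∀ {u v} → u ∈ V H → v ∈ V H → Star (_—_ H) u v
    acyclic   : ¬ Cycle (_—_ H)

-- An assignment of one of c colours to each edge; every edge is presented in
-- both orientations (i , j) and (j , i), so these must receive the same colour.
record EdgeColouring {n} (G : Graph n) (c : ℕ) : Set where
  field
    colour     : ∀ {i j} → _~_ G i j → Fin c
    colour-sym : ∀ {i j} (p : _~_ G i j) (q : _~_ G j i) → colour p ≡ colour q

open EdgeColouring public

-- Edges of H with the same colour are the same unordered pair.
Rainbow : ∀ {n c} {G : Graph n} → EdgeColouring G c → Subgraph G → Set
Rainbow χ H =
  ∀ {i j u v} (p : _—_ H i j) (q : _—_ H u v) →
  colour χ (—⇒~ H p) ≡ colour χ (—⇒~ H q) →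
  (i ≡ u × j ≡ v) ⊎ (i ≡ v × j ≡ u)

RainbowSTree : ∀ {n c} {G : Graph n} → EdgeColouring G c → Subset n → Set
RainbowSTree {G = G} χ S =
  Σ (Subgraph G) λ H → IsTree H × Rainbow χ H × S ⊆ V H

IsRainbowColouring : ∀ {n c} {G : Graph n} → ℕ → EdgeColouring G c → Set
IsRainbowColouring {n} k χ =
  ∀ (S : Subset n) → ∣ S ∣ ≡ k → RainbowSTree χ S

IsMinimum : (ℕ → Set) → ℕ → Set
IsMinimum P m = P m × (∀ m′ → P m′ → m ≤ m′)

-- rx k G r  says that r is the k-rainbow index rx_k(G).
rx : ∀ {n} → ℕ → Graph n → ℕ → Set
rx k G = IsMinimum λ c → Σ (EdgeColouring G c) (IsRainbowColouring k)

-- t n k ℓ m  says that the number t(n,k,ℓ) exists and equals m.  It is a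
-- relation because the minimum need not exist (e.g. t(n,n,ℓ) for ℓ < n - 1).
-- It is intended for 2 ≤ k ≤ n and 2 ≤ ℓ ≤ n - 1 only.
t : ℕ → ℕ → ℕ → ℕ → Set
t n k ℓ = IsMinimum λ m →
  Σ (Graph n) λ G → Connected G × size G ≡ m × (∃[ r ] rx k G r × r ≤ ℓ)

module Submission where

-- Every notion in the statement is decidable by exhaustive search over the
-- finitely many graphs, colourings, subgraphs and cycles on n vertices, so the
-- minimum t(n,3,4) is attained as soon as one graph qualifies.
--
-- The graph G is K_{n-1} minus one edge with a pendant vertex attached to one
-- end of that edge: the hubs 1 and 2 and the outer vertices 3, 4, … are pairwise
-- adjacent except for {2,3}, and 0 is adjacent to 2 only.  The edges between
-- outer vertices get colour 3, those from hub 1 to outer vertices colour 0,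
-- the edge {1,2} colour 2, and all other edges at hub 2 colour 1.  Hence the path
-- u — v — 1 — 2 — w is rainbow for all distinct outer u, v and every further vertex
-- w adjacent to 2, and every 3-set of vertices lies on such a path.

open import Defs
open import Data.Bool.Base using (Bool; true; false; T; not; _∨_)
open import Data.Bool.Properties using (T?; T-irrelevant; ∨-comm)
open import Data.Fin.Base as Fin using (Fin; zero; suc; toℕ; fromℕ; fromℕ<; inject₁)
open import Data.Fin.Induction using (<-weakInduction)
open import Data.Fin.Patterns using (0F; 1F; 2F; 3F)
open import Data.Fin.Properties using (_≟_; any?; all?; ∀-cons; injective⇒≤; inject₁-injective; suc-injective; toℕ-fromℕ<)
open import Data.Fin.Relation.Unary.Top using (view; ‵fromℕ; ‵inject₁)
open import Data.Fin.Subset using (Subset; _∈_; _⊆_; ∣_∣; inside; outside)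
open import Data.Fin.Subset.Properties using (_∈?_; _⊆?_; nonempty?; anySubset?; ∣p∣≤n; ∣p∣≤∣x∷p∣)
open import Data.List.Base as List using (List; []; _∷_; _++_; length; allFin; cartesianProduct)
open import Data.List.Membership.Propositional using () renaming (_∈_ to _∈ₗ_)
import Data.List.Membership.Propositional.Properties as ∈ₗ
import Data.List.Properties as List
import Data.List.Relation.Unary.All as All
import Data.List.Relation.Unary.AllPairs as AllPairs
open import Data.List.Relation.Unary.Any using (here; there)
import Data.List.Relation.Unary.Unique.Propositional as List
import Data.List.Relation.Unary.Unique.Propositional.Properties as Uniqueₗ
open import Data.Nat.Base using (ℕ; zero; suc; _+_; _∸_; _≤_; _<_; z≤n; s≤s; s≤s⁻¹)
open import Data.Nat.Combinatorics using (_C_; nCk+nC[k+1]≡[n+1]C[k+1]; nC1≡n)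
import Data.Nat.Properties as ℕ
open import Data.Nat.Tactic.RingSolver using (solve-∀)
open import Data.Product.Base using (Σ; ∃; ∃-syntax; _×_; _,_; proj₁; proj₂)
open import Data.Sum.Base using (_⊎_; inj₁; inj₂)
open import Data.Vec.Base as Vec using (Vec; []; _∷_; lookup; tabulate; here; there)
open import Data.Vec.Membership.Propositional using () renaming (_∈_ to _∈ᵥ_)
open import Data.Vec.Membership.Propositional.Properties using (∈-map⁺)
import Data.Vec.Properties as Vec
import Data.Vec.Relation.Unary.All as VecAll
import Data.Vec.Relation.Unary.AllPairs as VecPairs
open import Data.Vec.Relation.Unary.Any using (index) renaming (here to hereᵥ; there to thereᵥ)
open import Data.Vec.Relation.Unary.Any.Properties using (lookup-index)
open import Data.Vec.Relation.Unary.Unique.Propositional using (Unique)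
import Data.Vec.Relation.Unary.Unique.Propositional.Properties as Unique
open import Function.Base using (_∘_; const; id; case_of_)
open import Function.Definitions using (Injective)
open import Relation.Binary.Construct.Closure.ReflexiveTransitive as Star using (Star; ε; _◅_; _◅◅_)
open import Relation.Binary.Definitions using () renaming (Decidable to Decidable₂)
open import Relation.Binary.PropositionalEquality using (_≡_; _≢_; _≗_; refl; sym; trans; cong; cong₂; subst; subst₂; module ≡-Reasoning)
open import Relation.Nullary.Decidable using (Dec; yes; no; does; ⌊_⌋; isYes≗does; map′; toWitness; fromWitness; dec-true; dec-false; decidable-stable; ¬?; _×-dec_; _⊎-dec_; _→-dec_)
open import Relation.Nullary.Negation using (¬_; contradiction)
open import Relation.Unary using (Decidable)

-- Exhaustive search over finite types

-- Functions out of Fin n can be enumerated only up to pointwise equality, so a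
-- search succeeds only for predicates that respect _≈_.
Searchable : {A : Set} → (A → A → Set) → Set₁
Searchable {A} _≈_ =
  ∀ {P : A → Set} → (∀ {x y} → x ≈ y → P x → P y) → Decidable P → Dec (∃ P)

Fin-searchable : ∀ {n} → Searchable {Fin n} _≡_
Fin-searchable _ = any?

Bool-searchable : Searchable {Bool} _≡_
Bool-searchable _ P? = map′
  (λ { (inj₁ p) → true , p ; (inj₂ p) → false , p })
  (λ { (true , p) → inj₁ p ; (false , p) → inj₂ p })
  (P? true ⊎-dec P? false)

-- Induction on `n`: search the value at `zero` and, for each candidate, the rest of the function. A
-- function found elsewhere is only pointwise equal to `∀-cons` of its head and tail, which is where
-- `resp` enters.
Π-searchable : ∀ {n} {A : Fin n → Set} {_≈_ : ∀ {i} → A i → A i → Set} →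
               (∀ {i} {x : A i} → x ≈ x) → (∀ i → Searchable (_≈_ {i})) →
               Searchable {∀ i → A i} (λ f g → ∀ i → f i ≈ g i)
Π-searchable {zero} {A} refl≈ search resp P? =
  map′ (empty ,_) (λ (f , p) → resp (λ ()) p) (P? empty)
  where
  empty : ∀ i → A i
  empty ()
Π-searchable {suc n} refl≈ search {P} resp P? = map′
  (λ (x , f , p) → ∀-cons x f , p)
  (λ (f , p) → f zero , f ∘ suc , resp (λ { zero → refl≈ ; (suc i) → refl≈ }) p)
  (search zero
    (λ x≈y (f , p) → f , resp (λ { zero → x≈y ; (suc i) → refl≈ }) p)
    (λ x → Π-searchable refl≈ (search ∘ suc)
      (λ f≈g → resp (λ { zero → refl≈ ; (suc i) → f≈g i }))
      (λ f → P? (∀-cons x f))))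

-- `T b` is empty or a unit type, so such a function carries no value or exactly one. This handles
-- colourings, whose values take a proof of adjacency as argument.
T→-searchable : ∀ {b} {A : Set} {_≈_ : A → A → Set} →
                (∀ {x} → x ≈ x) → Searchable _≈_ →
                Searchable {T b → A} (λ f g → ∀ p → f p ≈ g p)
T→-searchable {false} {A} refl≈ search resp P? =
  map′ (empty ,_) (λ (f , p) → resp (λ ()) p) (P? empty)
  where
  empty : T false → A
  empty ()
T→-searchable {true} refl≈ search resp P? = map′
  (λ (x , p) → const x , p)
  (λ (f , p) → f _ , resp (λ _ → refl≈) p)
  (search (λ x≈y → resp (λ _ → x≈y)) (P? ∘ const))

Matrix-searchable : ∀ {m n} {A : Fin m → Fin n → Set} {_≈_ : ∀ {i j} → A i j → A i j → Set} →
                    (∀ {i j} {x : A i j} → x ≈ x) → (∀ i j → Searchable (_≈_ {i} {j})) →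
                    Searchable {∀ i j → A i j} (λ f g → ∀ i j → f i j ≈ g i j)
Matrix-searchable {_≈_ = _≈_} refl≈ search =
  Π-searchable {_≈_ = λ f g → ∀ j → f j ≈ g j} (λ _ → refl≈) (λ i → Π-searchable refl≈ (search i))

allSubset? : ∀ {n} {P : Subset n → Set} → Decidable P → Dec (∀ S → P S)
allSubset? P? = map′
  (λ ¬∃¬P S → decidable-stable (P? S) (λ ¬p → ¬∃¬P (S , ¬p)))
  (λ ∀P (S , ¬p) → ¬p (∀P S))
  (¬? (anySubset? (¬? ∘ P?)))

∀T? : ∀ {b} {P : T b → Set} → Decidable P → Dec (∀ p → P p)
∀T? {false} P? = yes λ ()
∀T? {true}  P? = map′ (λ p _ → p) (λ f → f _) (P? _)

-- `A` will be the laws of a structure and `B` a property of the structure built from them. `irr`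
-- stands in for uniqueness of proofs of `A`: failure of `B` at the one proof found refutes it at
-- every proof.
Σ-dec : ∀ {A : Set} {B : A → Set} → Dec A → (∀ {x y} → B x → B y) → Decidable B → Dec (Σ A B)
Σ-dec (no ¬a) irr B? = no (¬a ∘ proj₁)
Σ-dec (yes a) irr B? = map′ (a ,_) (irr ∘ proj₂) (B? a)

-- Searching upwards from 0 stops at the latest at the given witness. The bound `m ≤ n` is what
-- turns a construction into an upper bound for a minimum.
least : ∀ {P : ℕ → Set} → Decidable P → ∀ {n} → P n → ∃[ m ] IsMinimum P m × m ≤ n
least P? {n} p with P? 0
... | yes p₀ = 0 , (p₀ , λ _ _ → z≤n) , z≤n
least P? {zero} p | no ¬p₀ = contradiction p ¬p₀
least {P} P? {suc n} p | no ¬p₀ with least (P? ∘ suc) p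
... | m , (pm , min) , m≤n = suc m , (pm , min′) , s≤s m≤n
  where
  min′ : ∀ m′ → P m′ → suc m ≤ m′
  min′ zero    p′ = contradiction p′ ¬p₀
  min′ (suc m′) p′ = s≤s (min m′ p′)

-- Decidability of reachability

module _ {n : ℕ} (R : Fin n → Fin n → Set) where

  -- Walks all of whose inner vertices lie in the list, as in the
  -- Floyd–Warshall algorithm.
  WalkVia : List (Fin n) → Fin n → Fin n → Set
  WalkVia []       u v = u ≡ v ⊎ R u v
  WalkVia (w ∷ ws) u v = WalkVia ws u v ⊎ (WalkVia ws u w × WalkVia ws w v)

  walkVia? : Decidable₂ R → ∀ ws → Decidable₂ (WalkVia ws)
  walkVia? R? []       u v = (u ≟ v) ⊎-dec R? u v
  walkVia? R? (w ∷ ws) u v =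
    walkVia? R? ws u v ⊎-dec (walkVia? R? ws u w ×-dec walkVia? R? ws w v)

  walkVia⇒Star : ∀ ws {u v} → WalkVia ws u v → Star R u v
  walkVia⇒Star []       (inj₁ refl)    = ε
  walkVia⇒Star []       (inj₂ r)       = r ◅ ε
  walkVia⇒Star (w ∷ ws) (inj₁ p)       = walkVia⇒Star ws p
  walkVia⇒Star (w ∷ ws) (inj₂ (p , q)) = walkVia⇒Star ws p ◅◅ walkVia⇒Star ws q

  walkVia-[] : ∀ ws {u v} → WalkVia [] u v → WalkVia ws u v
  walkVia-[] []       p = p
  walkVia-[] (w ∷ ws) p = inj₁ (walkVia-[] ws p)

  -- If `w` is the head of the list, `to` and `from` cut both walks so that they meet the head only
  -- at their common end. Otherwise recursion applies, except that when both walks pass through the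
  -- head, the closed detour from the head through `w` and back is dropped.
  walkVia-trans : ∀ {ws u v w} → w ∈ₗ ws → WalkVia ws u w → WalkVia ws w v → WalkVia ws u v
  walkVia-trans {x ∷ ws} {u} {v} (here refl) p q = inj₂ (to p , from q)
    where
    to : WalkVia (x ∷ ws) u x → WalkVia ws u x
    to (inj₁ p)       = p
    to (inj₂ (p , _)) = p
    from : WalkVia (x ∷ ws) x v → WalkVia ws x v
    from (inj₁ q)       = q
    from (inj₂ (_ , q)) = q
  walkVia-trans (there w∈ws) (inj₁ p)        (inj₁ q)        = inj₁ (walkVia-trans w∈ws p q)
  walkVia-trans (there w∈ws) (inj₁ p)        (inj₂ (q , q′)) = inj₂ (walkVia-trans w∈ws p q , q′)
  walkVia-trans (there w∈ws) (inj₂ (p , p′)) (inj₁ q)        = inj₂ (p , walkVia-trans w∈ws p′ q)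
  walkVia-trans (there w∈ws) (inj₂ (p , _))  (inj₂ (_ , q))  = inj₂ (p , q)

  Star⇒walkVia : ∀ {u v} → Star R u v → WalkVia (allFin n) u v
  Star⇒walkVia ε        = walkVia-[] _ (inj₁ refl)
  Star⇒walkVia (r ◅ rs) =
    walkVia-trans (∈ₗ.∈-allFin _) (walkVia-[] _ (inj₂ r)) (Star⇒walkVia rs)

  star? : Decidable₂ R → Decidable₂ (Star R)
  star? R? u v = map′ (walkVia⇒Star _) Star⇒walkVia (walkVia? R? _ u v)

-- Decidability of trees and rainbow trees

mapCycle : ∀ {n} {R Q : Fin n → Fin n → Set} → (∀ {i j} → R i j → Q i j) → Cycle R → Cycle Q
mapCycle f c = record
  { k           = k
  ; vertex      = vertex
  ; distinct    = distinct
  ; consecutive = f ∘ consecutive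
  ; closing     = f closing
  } where open Cycle c

injective? : ∀ {m n} (f : Fin m → Fin n) → Dec (Injective _≡_ _≡_ f)
injective? f = map′ (λ inj → inj _ _) (λ inj _ _ → inj)
  (all? λ i → all? λ j → (f i ≟ f j) →-dec (i ≟ j))

module _ {n : ℕ} (R : Fin n → Fin n → Set) where

  CycleLaws : ∀ k → (Fin (3 + k) → Fin n) → Set
  CycleLaws k f = Injective _≡_ _≡_ f × (∀ i → R (f (inject₁ i)) (f (suc i)))
                × R (f (fromℕ (2 + k))) (f zero)

  cycleLaws-resp : ∀ {k f g} → f ≗ g → CycleLaws k f → CycleLaws k g
  cycleLaws-resp f≗g (inj , con , clo) =
    (λ {x} {y} gx≡gy → inj (trans (f≗g x) (trans gx≡gy (sym (f≗g y))))) ,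
    (λ i → subst₂ R (f≗g _) (f≗g _) (con i)) ,
    subst₂ R (f≗g _) (f≗g _) clo

  -- The vertices of a cycle are distinct, so `3 + k ≤ n`; hence `k < n`, and only finitely many
  -- lengths have to be searched.
  cycle? : Decidable₂ R → Dec (Cycle R)
  cycle? R? = map′ to from (any? λ k → Π-searchable refl (λ _ → Fin-searchable)
      cycleLaws-resp
      (λ f → injective? f ×-dec (all? λ i → R? _ _) ×-dec R? _ _))
    where
    to : (∃ λ k → ∃ (CycleLaws (toℕ {n} k))) → Cycle R
    to (k , f , inj , con , clo) = record
      { k = toℕ k ; vertex = f ; distinct = inj ; consecutive = con ; closing = clo }
    from : Cycle R → ∃ λ k → ∃ (CycleLaws (toℕ {n} k))
    from c = fromℕ< k<n , subst (λ k → ∃ (CycleLaws k)) (sym (toℕ-fromℕ< k<n))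
               (vertex , distinct , consecutive , closing)
      where
      open Cycle c
      k<n : k < n
      k<n = ℕ.≤-trans (s≤s (ℕ.m≤n+m k 2)) (injective⇒≤ distinct)

isTree? : ∀ {n} {G : Graph n} (H : Subgraph G) → Dec (IsTree H)
isTree? H = map′
  (λ (ne , con , acy) → record { nonempty = ne ; connected = con _ _ ; acyclic = acy })
  (λ t → let open IsTree t in nonempty , (λ _ _ → connected) , acyclic)
  (nonempty? (V H)
    ×-dec (all? λ u → all? λ v → (u ∈? V H) →-dec ((v ∈? V H) →-dec star? _ —? u v))
    ×-dec ¬? (cycle? _ —?))
  where
  —? : Decidable₂ (_—_ H)
  —? i j = T? (sadj H i j)

-- Being a tree does not depend on the host graph, so `G` and `G′` may differ; this lets a tree be
-- carried to a graph with pointwise equal adjacency.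
isTree-resp : ∀ {n} {G G′ : Graph n} (H : Subgraph G) (H′ : Subgraph G′) →
              V H ≡ V H′ → (∀ i j → sadj H i j ≡ sadj H′ i j) → IsTree H → IsTree H′
isTree-resp H H′ refl sadj≡ t = record
  { nonempty  = nonempty
  ; connected = λ u∈V v∈V → Star.map (subst T (sadj≡ _ _)) (connected u∈V v∈V)
  ; acyclic   = acyclic ∘ mapCycle (subst T (sym (sadj≡ _ _)))
  } where open IsTree t

rainbow? : ∀ {n c} {G : Graph n} (χ : EdgeColouring G c) (H : Subgraph G) → Dec (Rainbow χ H)
rainbow? χ H = map′ (λ r → r _ _ _ _) (λ r _ _ _ _ → r)
  (all? λ i → all? λ j → all? λ u → all? λ v → ∀T? λ p → ∀T? λ q →
    (_ ≟ _) →-dec (((i ≟ u) ×-dec (j ≟ v)) ⊎-dec ((i ≟ v) ×-dec (j ≟ u))))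

-- The adjacency proofs `p` and `q` are quantified separately because they belong to different
-- graphs.
SameColours : ∀ {n c} {G G′ : Graph n} → EdgeColouring G c → EdgeColouring G′ c → Set
SameColours χ χ′ = ∀ i j p q → colour χ {i} {j} p ≡ colour χ′ {i} {j} q

rainbow-resp : ∀ {n c} {G G′ : Graph n} {χ : EdgeColouring G c} {χ′ : EdgeColouring G′ c} →
               SameColours χ χ′ → (H : Subgraph G) (H′ : Subgraph G′) →
               (∀ i j → sadj H i j ≡ sadj H′ i j) → Rainbow χ H → Rainbow χ′ H′
rainbow-resp χ≈χ′ H H′ sadj≡ r p q eq =
  r (subst T (sym (sadj≡ _ _)) p) (subst T (sym (sadj≡ _ _)) q)
    (trans (χ≈χ′ _ _ _ _) (trans eq (sym (χ≈χ′ _ _ _ _))))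

sameColours-refl : ∀ {n c} {G : Graph n} (χ : EdgeColouring G c) → SameColours χ χ
sameColours-refl χ _ _ p q = cong (colour χ) (T-irrelevant p q)

module _ {n : ℕ} (G : Graph n) (V : Subset n) where

  SubgraphLaws : (Fin n → Fin n → Bool) → Set
  SubgraphLaws E = (∀ i j → T (E i j) → T (E j i))
                 × (∀ i j → T (E i j) → T (adj G i j))
                 × (∀ i j → T (E i j) → i ∈ V)

  subgraphLaws? : Decidable SubgraphLaws
  subgraphLaws? E = (all? λ i → all? λ j → T? _ →-dec T? _)
    ×-dec (all? λ i → all? λ j → T? _ →-dec T? _)
    ×-dec (all? λ i → all? λ j → T? _ →-dec (i ∈? V))

  subgraphLaws-resp : ∀ {E F} → (∀ i j → E i j ≡ F i j) → SubgraphLaws E → SubgraphLaws F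
  subgraphLaws-resp E≡F (s , g , v) =
    (λ i j → subst T (E≡F j i) ∘ s i j ∘ subst T (sym (E≡F i j))) ,
    (λ i j → g i j ∘ subst T (sym (E≡F i j))) ,
    (λ i j → v i j ∘ subst T (sym (E≡F i j)))

  subgraph : ∀ {E} → SubgraphLaws E → Subgraph G
  subgraph {E} (s , g , v) = record
    { V = V ; sadj = E ; —-sym = s _ _ ; —⇒~ = g _ _ ; —⇒endpoint = v _ _ }

-- The vertex set is searched first, then the edge matrix up to pointwise equality; the remaining
-- fields of `Subgraph` are laws, decided afterwards.
rainbowSTree? : ∀ {n c} {G : Graph n} (χ : EdgeColouring G c) (S : Subset n) → Dec (RainbowSTree χ S)
rainbowSTree? {n} {G = G} χ S = map′
  (λ (W , E , laws , p) → subgraph G W laws , p)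
  (λ (H , p) → V H , sadj H , ((λ _ _ → —-sym H) , (λ _ _ → —⇒~ H) , (λ _ _ → —⇒endpoint H)) , p)
  (anySubset? λ W → Matrix-searchable refl (λ _ _ → Bool-searchable)
    (λ E≡F (laws , p) → subgraphLaws-resp G W E≡F laws , resp W E≡F p)
    (λ E → Σ-dec (subgraphLaws? G W E) (resp W (λ _ _ → refl))
      (λ laws → isTree? _ ×-dec rainbow? χ (subgraph G W laws) ×-dec (S ⊆? W))))
  where
  resp : ∀ W {E F laws laws′} → (∀ i j → E i j ≡ F i j) →
         let H = subgraph G W {E} laws ; H′ = subgraph G W {F} laws′ in
         IsTree H × Rainbow χ H × S ⊆ W → IsTree H′ × Rainbow χ H′ × S ⊆ W
  resp W {laws = laws} {laws′} E≡F (t , r , S⊆W) =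
    isTree-resp H H′ refl E≡F t , rainbow-resp {χ = χ} {χ} (sameColours-refl χ) H H′ E≡F r , S⊆W
    where
    H = subgraph G W laws
    H′ = subgraph G W laws′

isRainbowColouring-resp : ∀ {n c k} {G G′ : Graph n} {χ : EdgeColouring G c} {χ′ : EdgeColouring G′ c} →
  (∀ i j → adj G i j ≡ adj G′ i j) → SameColours χ χ′ →
  IsRainbowColouring k χ → IsRainbowColouring k χ′
isRainbowColouring-resp {G′ = G′} {χ} {χ′} adj≡ χ≈χ′ rc S ∣S∣≡k with rc S ∣S∣≡k
... | H , t , r , S⊆V =
  H′ , isTree-resp H H′ refl (λ _ _ → refl) t ,
  rainbow-resp {χ = χ} {χ′} χ≈χ′ H H′ (λ _ _ → refl) r , S⊆V
  where
  H′ : Subgraph G′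
  H′ = record { V = V H ; sadj = sadj H ; —-sym = —-sym H
              ; —⇒~ = subst T (adj≡ _ _) ∘ —⇒~ H ; —⇒endpoint = —⇒endpoint H }

isRainbowColouring? : ∀ {n c} {G : Graph n} k (χ : EdgeColouring G c) → Dec (IsRainbowColouring k χ)
isRainbowColouring? k χ = allSubset? λ S → (∣ S ∣ ℕ.≟ k) →-dec rainbowSTree? χ S

-- Existence of the rainbow index and of the minimum size

Colourable : ∀ {n} → ℕ → Graph n → ℕ → Set
Colourable k G c = Σ (EdgeColouring G c) (IsRainbowColouring k)

module _ {n : ℕ} (G : Graph n) where

  colouring : ∀ {c} {f : ∀ i j → T (adj G i j) → Fin c} →
              (∀ i j p q → f i j p ≡ f j i q) → EdgeColouring G c
  colouring {f = f} f-sym = record { colour = f _ _ ; colour-sym = f-sym _ _ }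

  colourable? : ∀ k → Decidable (Colourable k G)
  colourable? k c = map′
    (λ (f , f-sym , rc) → colouring f-sym , rc)
    (λ (χ , rc) → (λ _ _ → colour χ) , (λ _ _ → colour-sym χ) , rc)
    (Matrix-searchable {_≈_ = λ f g → ∀ p → f p ≡ g p}
      (λ _ → refl) (λ _ _ → T→-searchable refl Fin-searchable)
      (λ f≡g (f-sym , rc) →
        (λ i j p q → trans (sym (f≡g i j p)) (trans (f-sym i j p q) (f≡g j i q))) ,
        resp {f-sym = f-sym} {λ i j p q → trans (sym (f≡g i j p)) (trans (f-sym i j p q) (f≡g j i q))} f≡g rc)
      (λ f → Σ-dec (all? λ i → all? λ j → ∀T? λ p → ∀T? λ q → _ ≟ _)
        (λ {x} {y} → resp {f} {f} {x} {y} (λ _ _ _ → refl)) (isRainbowColouring? k ∘ colouring)))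
    where
    resp : ∀ {f g f-sym g-sym} → (∀ i j p → f i j p ≡ g i j p) →
           IsRainbowColouring k (colouring {c} {f} f-sym) → IsRainbowColouring k (colouring {c} {g} g-sym)
    resp {f} {g} {fs} {gs} f≡g = isRainbowColouring-resp {χ = colouring fs} {χ′ = colouring gs}
      (λ _ _ → refl) (λ i j p q → trans (f≡g i j p) (cong (g i j) (T-irrelevant p q)))

colourable-resp : ∀ {n k c} {G G′ : Graph n} → (∀ i j → adj G i j ≡ adj G′ i j) →
                  Colourable k G c → Colourable k G′ c
colourable-resp {G = G} {G′} adj≡ (χ , rc) =
  χ′ , isRainbowColouring-resp {χ = χ} {χ′} adj≡ (λ i j p q → cong (colour χ {i} {j}) (T-irrelevant p _)) rc
  where
  χ′ : EdgeColouring G′ _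
  χ′ = record
    { colour     = colour χ ∘ subst T (sym (adj≡ _ _))
    ; colour-sym = λ _ _ → colour-sym χ _ _ }

size-resp : ∀ {n} {G G′ : Graph n} → (∀ i j → adj G i j ≡ adj G′ i j) → size G ≡ size G′
size-resp {n} adj≡ = cong length (List.filter-≐ _ _
  ((λ (i<j , e) → i<j , subst T (adj≡ _ _) e) , (λ (i<j , e) → i<j , subst T (sym (adj≡ _ _)) e))
  (cartesianProduct (allFin n) (allFin n)))

-- The bound on the rainbow index is replaced by colourability with at most `ℓ` colours. This makes
-- the existential a bounded search, and `c < suc ℓ` is the form that `ℕ.anyUpTo?` expects.
HasGraph : (n k ℓ m : ℕ) → Set
HasGraph n k ℓ m = Σ (Graph n) λ G → Connected G × size G ≡ m × (∃[ c ] c < suc ℓ × Colourable k G c)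

module _ {n : ℕ} where

  GraphLaws : (Fin n → Fin n → Bool) → Set
  GraphLaws A = (∀ i j → T (A i j) → T (A j i)) × (∀ i → ¬ T (A i i))

  graph : ∀ {A} → GraphLaws A → Graph n
  graph {A} (s , irr) = record { adj = A ; ~-sym = s _ _ ; ~-irrefl = irr _ }

hasGraph? : ∀ n k ℓ → Decidable (HasGraph n k ℓ)
hasGraph? n k ℓ m = map′
  (λ (A , laws , p) → graph laws , p)
  (λ (G , p) → adj G , ((λ _ _ → ~-sym G) , (λ _ → ~-irrefl G)) , p)
  (Matrix-searchable refl (λ _ _ → Bool-searchable)
    (λ A≡B ((s , irr) , p) →
      ((λ i j → subst T (A≡B j i) ∘ s i j ∘ subst T (sym (A≡B i j))) ,
       (λ i → irr i ∘ subst T (sym (A≡B i i)))) ,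
      resp A≡B p)
    (λ A → Σ-dec
      ((all? λ i → all? λ j → T? _ →-dec T? _) ×-dec (all? λ i → ¬? (T? _)))
      (resp (λ _ _ → refl))
      (λ laws → (all? λ u → all? λ v → star? _ (λ i j → T? (A i j)) u v)
        ×-dec (_ ℕ.≟ m)
        ×-dec ℕ.anyUpTo? (colourable? _ k) (suc ℓ))))
  where
  Good : Graph n → Set
  Good G = Connected G × size G ≡ m × (∃[ c ] c < suc ℓ × Colourable k G c)
  resp : ∀ {A B lawsA lawsB} → (∀ i j → A i j ≡ B i j) → Good (graph {A = A} lawsA) → Good (graph {A = B} lawsB)
  resp {A} {B} {la} {lb} A≡B (con , sz , c , c<ℓ , col) =
    (λ u v → Star.map (subst T (A≡B _ _)) (con u v)) ,
    trans (size-resp {G = graph lb} {graph la} (λ i j → sym (A≡B i j))) sz ,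
    c , c<ℓ , colourable-resp {G = graph la} {graph lb} A≡B col

rx-exists : ∀ {n k c} {G : Graph n} → Colourable k G c → ∃[ r ] rx k G r × r ≤ c
rx-exists {k = k} {G = G} = least (colourable? G k)

-- Both conditions select the same graphs: a colouring with at most `ℓ` colours bounds the rainbow
-- index by `rx-exists`, and conversely the rainbow index is attained by a colouring.
minimum⇒t : ∀ {n k ℓ m} → IsMinimum (HasGraph n k ℓ) m → t n k ℓ m
minimum⇒t ((G , con , sz , c , c<ℓ , col) , min) =
  let r , rx-r , r≤c = rx-exists col in
  (G , con , sz , r , rx-r , ℕ.≤-trans r≤c (s≤s⁻¹ c<ℓ)) ,
  λ m′ (G′ , con′ , sz′ , r′ , (col′ , _) , r′≤ℓ) → min m′ (G′ , con′ , sz′ , r′ , s≤s r′≤ℓ , col′)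

t-exists : ∀ {n k ℓ m} → HasGraph n k ℓ m → ∃[ m′ ] t n k ℓ m′ × m′ ≤ m
t-exists p = let m′ , min , m′≤m = least (hasGraph? _ _ _) p in m′ , minimum⇒t min , m′≤m

-- Rainbow paths as rainbow trees

-- The two neighbours are the cyclic predecessor and successor, which differ because a cycle has at
-- least three vertices. The closing edge supplies one of them at either end of the sequence.
cycle-neighbours : ∀ {n} {R : Fin n → Fin n → Set} (c : Cycle R) → (∀ {i j} → R i j → R j i) →
  let open Cycle c in
  ∀ i → ∃[ j ] ∃[ l ] vertex j ≢ vertex l × R (vertex i) (vertex j) × R (vertex i) (vertex l)
cycle-neighbours {R = R} c R-sym = neighbours
  where
  open Cycle c
  Neighbours : Fin (3 + k) → Set
  Neighbours i = ∃[ j ] ∃[ l ] vertex j ≢ vertex l × R (vertex i) (vertex j) × R (vertex i) (vertex l)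
  inject₁²≢suc² : ∀ {n} (j : Fin n) → inject₁ (inject₁ j) ≢ suc (suc j)
  inject₁²≢suc² (suc j) = inject₁²≢suc² j ∘ suc-injective
  neighbours : ∀ i → Neighbours i
  neighbours zero = fromℕ (2 + k) , suc zero , (λ ()) ∘ distinct , R-sym closing , consecutive zero
  neighbours (suc i) with view i
  ... | ‵fromℕ     = inject₁ i , zero , (λ ()) ∘ distinct , R-sym (consecutive i) , closing
  ... | ‵inject₁ j = inject₁ i , suc (suc j) , inject₁²≢suc² j ∘ distinct ,
                     R-sym (consecutive i) , consecutive (suc j)

module RainbowPath {n c m : ℕ} {G : Graph n} (χ : EdgeColouring G c) (p : Fin (suc m) → Fin n)
  (p-injective : Injective _≡_ _≡_ p)
  (e : ∀ k → _~_ G (p (inject₁ k)) (p (suc k)))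
  (rainbow : Injective _≡_ _≡_ (λ k → colour χ (e k)))
  where

  -- The index of the edge along the path is kept, so that acyclicity and rainbowness reduce to
  -- comparing indices. The disjuncts are the two orientations.
  Link : Fin n → Fin n → Fin m → Set
  Link i j k = (i ≡ p (inject₁ k) × j ≡ p (suc k)) ⊎ (j ≡ p (inject₁ k) × i ≡ p (suc k))

  link? : ∀ i j → Dec (∃ (Link i j))
  link? i j = any? λ k →
    ((i ≟ p (inject₁ k)) ×-dec (j ≟ p (suc k))) ⊎-dec ((j ≟ p (inject₁ k)) ×-dec (i ≟ p (suc k)))

  onPath? : ∀ i → Dec (∃[ k ] i ≡ p k)
  onPath? i = any? λ k → i ≟ p k

  link-sym : ∀ {i j} → ∃ (Link i j) → ∃ (Link j i)
  link-sym (k , inj₁ l) = k , inj₂ l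
  link-sym (k , inj₂ l) = k , inj₁ l

  link⇒~ : ∀ {i j} → ∃ (Link i j) → _~_ G i j
  link⇒~ (k , inj₁ (refl , refl)) = e k
  link⇒~ (k , inj₂ (refl , refl)) = ~-sym G (e k)

  support : Subset n
  support = tabulate (λ i → ⌊ onPath? i ⌋)

  ∈-support⁺ : ∀ {i} → ∃[ k ] i ≡ p k → i ∈ support
  ∈-support⁺ {i} q = Vec.lookup⇒[]= i _ (trans (Vec.lookup∘tabulate _ i) (trans (isYes≗does (onPath? i)) (dec-true (onPath? i) q)))

  ∈-support⁻ : ∀ {i} → i ∈ support → ∃[ k ] i ≡ p k
  ∈-support⁻ {i} i∈ = toWitness {a? = onPath? i}
    (subst T (trans (sym (Vec.[]=⇒lookup i∈)) (Vec.lookup∘tabulate _ i)) _)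

  path : Subgraph G
  path = record
    { V          = support
    ; sadj       = λ i j → ⌊ link? i j ⌋
    ; —-sym      = λ {i} {j} l → fromWitness {a? = link? j i} (link-sym (toWitness {a? = link? i j} l))
    ; —⇒~        = λ {i} {j} l → link⇒~ (toWitness {a? = link? i j} l)
    ; —⇒endpoint = λ {i} {j} l → ∈-support⁺ (endpoint (toWitness {a? = link? i j} l))
    }
    where
    endpoint : ∀ {i j} → ∃ (Link i j) → ∃[ k ] i ≡ p k
    endpoint (k , inj₁ (i≡ , _)) = inject₁ k , i≡
    endpoint (k , inj₂ (_ , i≡)) = suc k , i≡

  path-connected : ∀ {i j} → i ∈ support → j ∈ support → Star (_—_ path) i j
  path-connected i∈ j∈ with ∈-support⁻ i∈ | ∈-support⁻ j∈
  ... | k , refl | l , refl = Star.reverse (—-sym path) (fromStart k) ◅◅ fromStart l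
    where
    fromStart : ∀ k → Star (_—_ path) (p zero) (p k)
    fromStart = <-weakInduction _ ε
      (λ k s → s ◅◅ (fromWitness {a? = link? _ _} (k , inj₁ (refl , refl)) ◅ ε))

  -- The vertices p k leave the cycle one after the other: once p (k - 1) is
  -- known to be off the cycle, p k has only one neighbour left.
  path-acyclic : ¬ Cycle (_—_ path)
  path-acyclic cyc with ∈-support⁻ (—⇒endpoint path (Cycle.closing cyc))
  ... | k , on = offCycle k _ on
    where
    open Cycle cyc using (vertex)

    neighbours : ∀ i → ∃[ j ] ∃[ l ] vertex j ≢ vertex l
               × ∃ (Link (vertex i) (vertex j)) × ∃ (Link (vertex i) (vertex l))
    neighbours i with cycle-neighbours cyc (—-sym path) i
    ... | j , l , j≢l , ij , il =
      j , l , j≢l , toWitness {a? = link? _ _} ij , toWitness {a? = link? _ _} il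

    Off : Fin (suc m) → Set
    Off k = ∀ i → vertex i ≢ p k

    step : ∀ k → (∀ j → suc j ≡ k → Off (inject₁ j)) → Off k
    step k off i i≡ with neighbours i
    ... | j , l , j≢l , a , b with forward j a | forward l b
      where
      forward : ∀ j → ∃ (Link (vertex i) (vertex j)) → ∃[ h ] k ≡ inject₁ h × vertex j ≡ p (suc h)
      forward j (h , inj₁ (i≡′ , j≡)) = h , p-injective (trans (sym i≡) i≡′) , j≡
      forward j (h , inj₂ (j≡ , i≡′)) =
        contradiction j≡ (off h (p-injective (trans (sym i≡′) i≡)) j)
    ...   | h , k≡h , j≡ | h′ , k≡h′ , l≡ =
      j≢l (trans j≡ (trans (cong (p ∘ suc) (inject₁-injective (trans (sym k≡h) k≡h′))) (sym l≡)))

    offCycle : ∀ k → Off k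
    offCycle = <-weakInduction Off (step zero λ _ ())
      (λ k off → step (suc k) λ j j≡k → subst (Off ∘ inject₁) (sym (suc-injective j≡k)) off)

  path-isTree : IsTree path
  path-isTree = record
    { nonempty  = p zero , ∈-support⁺ (zero , refl)
    ; connected = path-connected
    ; acyclic   = path-acyclic
    }

  -- In either orientation a link has the colour of the path edge with its index. Equal colours
  -- therefore force equal indices, and the four pairs of orientations give the two ways of matching
  -- endpoints.
  path-rainbow : Rainbow χ path
  path-rainbow {i} {j} {u} {v} x y eq =
    matching (toWitness {a? = link? i j} x) (toWitness {a? = link? u v} y) eq
    where
    linkColour : ∀ {i j} (l : ∃ (Link i j)) → colour χ (link⇒~ l) ≡ colour χ (e (proj₁ l))
    linkColour (k , inj₁ (refl , refl)) = refl
    linkColour (k , inj₂ (refl , refl)) = colour-sym χ _ _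
    matching : ∀ {i j u v} (a : ∃ (Link i j)) (b : ∃ (Link u v)) →
               colour χ (link⇒~ a) ≡ colour χ (link⇒~ b) →
               (i ≡ u × j ≡ v) ⊎ (i ≡ v × j ≡ u)
    matching a@(k , _) b@(l , _) eq
      with rainbow (trans (sym (linkColour a)) (trans eq (linkColour b)))
    matching (k , inj₁ (refl , refl)) (k , inj₁ (refl , refl)) eq | refl = inj₁ (refl , refl)
    matching (k , inj₁ (refl , refl)) (k , inj₂ (refl , refl)) eq | refl = inj₂ (refl , refl)
    matching (k , inj₂ (refl , refl)) (k , inj₁ (refl , refl)) eq | refl = inj₂ (refl , refl)
    matching (k , inj₂ (refl , refl)) (k , inj₂ (refl , refl)) eq | refl = inj₁ (refl , refl)

-- Enumerating subsets by distinct elements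

-- The elements of `S` are padded to exactly `j` distinct ones, so that a path of fixed length can
-- be laid through a set that may be smaller. Padding uses `zero` only when the later elements are
-- too few.
cover : ∀ {m} (S : Subset m) j → ∣ S ∣ ≤ j → j ≤ m →
        Σ (Vec (Fin m) j) λ xs → Unique xs × (∀ {i} → i ∈ S → i ∈ᵥ xs)
cover-suc : ∀ {m} s (S : Subset m) j → ∣ S ∣ ≤ j → j ≤ m →
            Σ (Vec (Fin (suc m)) (suc j)) λ xs → Unique xs × (∀ {i} → i ∈ s ∷ S → i ∈ᵥ xs)

cover [] zero _ _ = [] , VecPairs.[] , λ ()
cover (inside ∷ S) (suc j) (s≤s ∣S∣≤j) (s≤s j≤m) = cover-suc inside S j ∣S∣≤j j≤m
cover {suc m} (outside ∷ S) j ∣S∣≤j j≤1+m with j ℕ.≤? m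
... | yes j≤m with cover S j ∣S∣≤j j≤m
...   | xs , unique , S⊆xs =
  Vec.map suc xs , Unique.map⁺ suc-injective unique , λ { (there i∈S) → ∈-map⁺ suc (S⊆xs i∈S) }
cover {suc m} (outside ∷ S) j ∣S∣≤j j≤1+m | no j≰m
  -- Here `j` equals `suc m`, so every element has to be listed.
  with refl ← ℕ.≤-antisym j≤1+m (ℕ.≰⇒> j≰m) = cover-suc outside S m (∣p∣≤n S) ℕ.≤-refl

cover-suc s S j ∣S∣≤j j≤m with cover S j ∣S∣≤j j≤m
... | xs , unique , S⊆xs =
  zero ∷ Vec.map suc xs ,
  0∉ xs VecPairs.∷ Unique.map⁺ suc-injective unique ,
  λ { here → hereᵥ refl ; (there i∈S) → thereᵥ (∈-map⁺ suc (S⊆xs i∈S)) }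
  where
  0∉ : ∀ {m n} (xs : Vec (Fin m) n) → VecAll.All {A = Fin (suc m)} (zero ≢_) (Vec.map suc xs)
  0∉ []       = VecAll.[]
  0∉ (x ∷ xs) = (λ ()) VecAll.∷ 0∉ xs

-- Counting edges

-- Pigeonhole: deleting one occurrence of the head `x` from `ys` keeps the tail of `xs` inside,
-- since the tail avoids `x`.
unique-⊆⇒length≤ : ∀ {A : Set} {xs ys : List A} → List.Unique xs →
                   (∀ {x} → x ∈ₗ xs → x ∈ₗ ys) → length xs ≤ length ys
unique-⊆⇒length≤ AllPairs.[] _ = z≤n
unique-⊆⇒length≤ {xs = x ∷ xs} (x∉xs AllPairs.∷ unique) xs⊆ys with ∈ₗ.∈-∃++ (xs⊆ys (here refl))
... | as , bs , refl = ℕ.≤-trans (s≤s (unique-⊆⇒length≤ unique xs⊆))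
        (ℕ.≤-reflexive (sym (trans (List.length-++ as)
          (trans (ℕ.+-suc (length as) (length bs)) (cong suc (sym (List.length-++ as)))))))
  where
  xs⊆ : ∀ {y} → y ∈ₗ xs → y ∈ₗ as ++ bs
  xs⊆ y∈xs with ∈ₗ.∈-++⁻ as (xs⊆ys (there y∈xs))
  ... | inj₁ y∈as         = ∈ₗ.∈-++⁺ˡ y∈as
  ... | inj₂ (here refl)  = contradiction refl (All.lookup x∉xs y∈xs)
  ... | inj₂ (there y∈bs) = ∈ₗ.∈-++⁺ʳ as y∈bs

size≤length : ∀ {n} (G : Graph n) (xs : List (Fin n × Fin n)) →
              (∀ {i j} → i Fin.< j → _~_ G i j → (i , j) ∈ₗ xs) → size G ≤ length xs
size≤length {n} G xs covers = unique-⊆⇒length≤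
  (Uniqueₗ.filter⁺ _ (Uniqueₗ.cartesianProduct⁺ (Uniqueₗ.allFin⁺ n) (Uniqueₗ.allFin⁺ n)))
  (λ ij∈ → let _ , i<j , i~j = ∈ₗ.∈-filter⁻ _ {xs = cartesianProduct (allFin n) (allFin n)} ij∈ in covers i<j i~j)

mapPair : ∀ {A B : Set} → (A → B) → A × A → B × B
mapPair f (x , y) = f x , f y

increasingPairs : ∀ n → List (Fin n × Fin n)
increasingPairs zero    = []
increasingPairs (suc n) =
  List.map (λ j → zero , suc j) (allFin n) ++ List.map (mapPair suc) (increasingPairs n)

∈-increasingPairs : ∀ {n} {i j : Fin n} → i Fin.< j → (i , j) ∈ₗ increasingPairs n
∈-increasingPairs {suc n} {zero}  {suc j} _         = ∈ₗ.∈-++⁺ˡ (∈ₗ.∈-map⁺ _ (∈ₗ.∈-allFin j))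
∈-increasingPairs {suc n} {suc i} {suc j} (s≤s i<j) =
  ∈ₗ.∈-++⁺ʳ (List.map _ (allFin n)) (∈ₗ.∈-map⁺ _ (∈-increasingPairs i<j))

length-map-allFin : ∀ {A : Set} {n} (f : Fin n → A) → length (List.map f (allFin n)) ≡ n
length-map-allFin {n = n} f = trans (List.length-map f (allFin n)) (List.length-tabulate id)

[1+n]C2≡n+nC2 : ∀ n → suc n C 2 ≡ n + n C 2
[1+n]C2≡n+nC2 n = trans (sym (nCk+nC[k+1]≡[n+1]C[k+1] n 1)) (cong (_+ n C 2) (nC1≡n n))

length-increasingPairs : ∀ n → length (increasingPairs n) ≡ n C 2
length-increasingPairs zero    = refl
length-increasingPairs (suc n) = begin
  length (List.map _ (allFin n) ++ List.map (mapPair suc) (increasingPairs n))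
    ≡⟨ List.length-++ (List.map _ (allFin n)) ⟩
  length (List.map _ (allFin n)) + length (List.map (mapPair suc) (increasingPairs n))
    ≡⟨ cong₂ _+_ (length-map-allFin _) (List.length-map _ (increasingPairs n)) ⟩
  n + length (increasingPairs n)
    ≡⟨ cong (n +_) (length-increasingPairs n) ⟩
  n + n C 2
    ≡⟨ [1+n]C2≡n+nC2 n ⟨
  suc n C 2 ∎
  where open ≡-Reasoning

-- The graph and its colouring

data Role : Set where
  hub₁ hub₂ other : Role

module Construction (k : ℕ) where

  Vertex : Set
  Vertex = Fin (5 + k)

  pattern outer x = Fin.suc (Fin.suc (Fin.suc x))

  -- Each missing pair is listed in one orientation, and `G` symmetrises with `∨`. The final clause
  -- excludes loops.
  nonEdge : Vertex → Vertex → Bool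
  nonEdge 0F 2F = false
  nonEdge 0F _  = true
  nonEdge 2F 3F = true
  nonEdge i  j  = does (i ≟ j)

  nonEdge-refl : ∀ i → nonEdge i i ≡ true
  nonEdge-refl 0F        = refl
  nonEdge-refl 1F        = refl
  nonEdge-refl 2F        = refl
  nonEdge-refl (outer x) = dec-true (x ≟ x) refl

  G : Graph (5 + k)
  G = record
    { adj       = λ i j → not (nonEdge i j ∨ nonEdge j i)
    ; ~-sym     = λ {i} {j} → subst (T ∘ not) (∨-comm (nonEdge i j) (nonEdge j i))
    ; ~-irrefl  = λ {i} → subst (λ b → ¬ T (not (b ∨ nonEdge i i))) (sym (nonEdge-refl i)) id
    }

  infix 4 _∼_
  _∼_ : Vertex → Vertex → Set
  _∼_ = _~_ G

  outer∼outer : ∀ {x y} → x ≢ y → outer x ∼ outer y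
  outer∼outer {x} {y} x≢y
    rewrite dec-false (x ≟ y) x≢y | dec-false (y ≟ x) (x≢y ∘ sym) = _

  role : Vertex → Role
  role 1F = hub₁
  role 2F = hub₂
  role _  = other

  -- On edges the last clause applies only to two vertices of role `other`, since each hub is a
  -- single vertex. The pendant vertex also has role `other`, so its edge gets colour `1F`.
  roleColour : Role → Role → Fin 4
  roleColour hub₁  other = 0F
  roleColour other hub₁  = 0F
  roleColour hub₂  other = 1F
  roleColour other hub₂  = 1F
  roleColour hub₁  hub₂  = 2F
  roleColour hub₂  hub₁  = 2F
  roleColour _     _     = 3F

  roleColour-sym : ∀ r s → roleColour r s ≡ roleColour s r
  roleColour-sym hub₁  hub₁  = refl
  roleColour-sym hub₁  hub₂  = refl
  roleColour-sym hub₁  other = refl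
  roleColour-sym hub₂  hub₁  = refl
  roleColour-sym hub₂  hub₂  = refl
  roleColour-sym hub₂  other = refl
  roleColour-sym other hub₁  = refl
  roleColour-sym other hub₂  = refl
  roleColour-sym other other = refl

  χ : EdgeColouring G 4
  χ = record
    { colour     = λ {i} {j} _ → roleColour (role i) (role j)
    ; colour-sym = λ {i} {j} _ _ → roleColour-sym (role i) (role j)
    }

  connected : Connected G
  connected u v = Star.reverse (λ {i} {j} → ~-sym G {i} {j}) (fromHub u) ◅◅ fromHub v
    where
    fromHub : ∀ v → Star _∼_ 1F v
    fromHub 0F        = _◅_ {j = 2F} _ (_ ◅ ε)
    fromHub 1F        = ε
    fromHub 2F        = _ ◅ ε
    fromHub (outer x) = _ ◅ ε

  -- These are the neighbours of `2F` besides `1F`; `outer zero` is `3F`, the other end of the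
  -- deleted edge.
  data End : Vertex → Set where
    pendant : End 0F
    outer⁺  : ∀ x → End (outer (suc x))

  hub₂∼end : ∀ {w} → End w → 2F ∼ w
  hub₂∼end pendant    = _
  hub₂∼end (outer⁺ _) = _

  role-end : ∀ {w} → End w → role w ≡ other
  role-end pendant    = refl
  role-end (outer⁺ _) = refl

  hubPath : Fin (2 + k) → Fin (2 + k) → Vertex → Vec Vertex 5
  hubPath u v w = outer u ∷ outer v ∷ 1F ∷ 2F ∷ w ∷ []

  hubPath-unique : ∀ {u v w} → u ≢ v → End w → outer u ≢ w → outer v ≢ w → Unique (hubPath u v w)
  hubPath-unique u≢v end u≢w v≢w =
    ((u≢v ∘ suc-injective ∘ suc-injective ∘ suc-injective) ∷ (λ ()) ∷ (λ ()) ∷ u≢w ∷ []) ∷ₚ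
    ((λ ()) ∷ (λ ()) ∷ v≢w ∷ []) ∷ₚ
    ((λ ()) ∷ (λ { refl → case end of λ () }) ∷ []) ∷ₚ
    ((λ { refl → case end of λ () }) ∷ []) ∷ₚ [] ∷ₚ VecPairs.[]
    where
    open VecAll using ([]; _∷_)
    open VecPairs using () renaming (_∷_ to _∷ₚ_)

  outer-injective : ∀ {x y : Fin (2 + k)} → outer x ≡ outer y → x ≡ y
  outer-injective refl = refl

  hubPath-rainbow : ∀ {u v w} → u ≢ v → End w → outer u ≢ w → outer v ≢ w →
                   ∀ {S} → (∀ {i} → i ∈ S → i ∈ᵥ hubPath u v w) → RainbowSTree χ S
  hubPath-rainbow {u} {v} {w} u≢v end u≢w v≢w S⊆ =
    path , path-isTree , path-rainbow ,
    λ i∈S → ∈-support⁺ (index (S⊆ i∈S) , lookup-index (S⊆ i∈S))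
    where
    p : Fin 5 → Vertex
    p = lookup (hubPath u v w)
    e : ∀ i → p (inject₁ i) ∼ p (suc i)
    e 0F = outer∼outer u≢v
    e 1F = _
    e 2F = _
    e 3F = hub₂∼end end
    -- Along the path, the edges are outer to outer, outer to first hub, hub to hub, and second hub
    -- to end: each of the four colours occurs once.
    colours : Vec (Fin 4) 4
    colours = 3F ∷ 0F ∷ 2F ∷ 1F ∷ []
    colour-e : ∀ i → colour χ {p (inject₁ i)} {p (suc i)} (e i) ≡ lookup colours i
    colour-e 0F = refl
    colour-e 1F = refl
    colour-e 2F = refl
    colour-e 3F = cong (roleColour hub₂) (role-end end)
    rainbow : Injective _≡_ _≡_ (λ i → colour χ {p (inject₁ i)} {p (suc i)} (e i))
    rainbow {i} {j} eq = toWitness {a? = injective? (lookup colours)} _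
      (trans (sym (colour-e i)) (trans eq (colour-e j)))
    open RainbowPath χ p
      (Unique.lookup-injective (hubPath-unique u≢v end u≢w v≢w) _ _) e rainbow

  -- The split is on the number of outer vertices in the 3-set, recorded by the tail `S`. If at most
  -- two, they are padded to two and start the path, and the pendant vertex ends it, so `0F`, `1F`
  -- and `2F` all lie on it. If three, the 3-set is entirely outer and one of its members ends the
  -- path.
  coloured : IsRainbowColouring 3 χ
  coloured (s₀ ∷ s₁ ∷ s₂ ∷ S) ∣S∣≡3 with ∣ S ∣ ℕ.≤? 2
  ... | yes ∣S∣≤2 with cover S 2 ∣S∣≤2 (s≤s (s≤s z≤n))
  ...   | u ∷ v ∷ [] , ((u≢v VecAll.∷ _) VecPairs.∷ _) , S⊆ =
    hubPath-rainbow u≢v pendant (λ ()) (λ ()) λ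
      { here                        → thereᵥ (thereᵥ (thereᵥ (thereᵥ (hereᵥ refl))))
      ; (there here)                → thereᵥ (thereᵥ (hereᵥ refl))
      ; (there (there here))        → thereᵥ (thereᵥ (thereᵥ (hereᵥ refl)))
      ; (there (there (there i∈S))) → case S⊆ i∈S of λ
          { (hereᵥ refl)          → hereᵥ refl
          ; (thereᵥ (hereᵥ refl)) → thereᵥ (hereᵥ refl) }
      }
  -- The pendant vertex and three outer vertices would make at least four elements.
  coloured (inside ∷ s₁ ∷ s₂ ∷ S) ∣S∣≡3 | no ∣S∣≰2 =
    contradiction (ℕ.≤-trans (ℕ.≤-trans (∣p∣≤∣x∷p∣ s₂ S) (∣p∣≤∣x∷p∣ s₁ (s₂ ∷ S)))
      (ℕ.≤-reflexive (ℕ.suc-injective ∣S∣≡3))) ∣S∣≰2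
  coloured (outside ∷ s₁ ∷ s₂ ∷ S) ∣S∣≡3 | no ∣S∣≰2
    -- That there are three outer vertices at all follows from `S` having more than two elements;
    -- for `k = 0` this case is void.
    with cover S 3 (ℕ.≤-trans (ℕ.≤-trans (∣p∣≤∣x∷p∣ s₂ S) (∣p∣≤∣x∷p∣ s₁ (s₂ ∷ S)))
                     (ℕ.≤-reflexive ∣S∣≡3))
                   (ℕ.≤-trans (ℕ.≰⇒> ∣S∣≰2) (∣p∣≤n S))
  ... | x ∷ y ∷ z ∷ [] , ((x≢y VecAll.∷ x≢z VecAll.∷ _) VecPairs.∷ (y≢z VecAll.∷ _) VecPairs.∷ _) , S⊆
    -- The end of the path must not be `outer zero`. If `z` is `zero`, then `x` is not, by
    -- distinctness, and `x` takes its place as the end.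
    with z
  ...   | suc z = hubPath-rainbow x≢y (outer⁺ z) (x≢z ∘ outer-injective) (y≢z ∘ outer-injective) λ
    { (there here)         → thereᵥ (thereᵥ (hereᵥ refl))
    ; (there (there here)) → thereᵥ (thereᵥ (thereᵥ (hereᵥ refl)))
    ; (there (there (there i∈S))) → case S⊆ i∈S of λ
        { (hereᵥ refl)                   → hereᵥ refl
        ; (thereᵥ (hereᵥ refl))          → thereᵥ (hereᵥ refl)
        ; (thereᵥ (thereᵥ (hereᵥ refl))) → thereᵥ (thereᵥ (thereᵥ (thereᵥ (hereᵥ refl)))) }
    }
  ...   | zero with x
  ...     | zero  = contradiction refl x≢z
  ...     | suc x = hubPath-rainbow y≢z (outer⁺ x) (x≢y ∘ sym ∘ outer-injective) (x≢z ∘ sym ∘ outer-injective) λ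
    { (there here)         → thereᵥ (thereᵥ (hereᵥ refl))
    ; (there (there here)) → thereᵥ (thereᵥ (thereᵥ (hereᵥ refl)))
    ; (there (there (there i∈S))) → case S⊆ i∈S of λ
        { (hereᵥ refl)                   → thereᵥ (thereᵥ (thereᵥ (thereᵥ (hereᵥ refl))))
        ; (thereᵥ (hereᵥ refl))          → hereᵥ refl
        ; (thereᵥ (thereᵥ (hereᵥ refl))) → thereᵥ (hereᵥ refl) }
    }

  -- Size of the constructed graph

  edgesFrom₁ edgesFrom₂ outerEdges allEdges : List (Vertex × Vertex)
  edgesFrom₁ = List.map (λ j → 1F , suc (suc j)) (allFin (3 + k))
  -- The inner `suc` skips the deleted edge from `2F` to `3F`.
  edgesFrom₂ = List.map (λ j → 2F , outer (suc j)) (allFin (1 + k))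
  outerEdges = List.map (mapPair (λ x → outer x)) (increasingPairs (2 + k))
  allEdges   = (0F , 2F) ∷ edgesFrom₁ ++ edgesFrom₂ ++ outerEdges

  ∈-allEdges : ∀ {i j} → i Fin.< j → i ∼ j → (i , j) ∈ₗ allEdges
  ∈-allEdges {0F} {2F} _ _ = here refl
  ∈-allEdges {1F} {1F} (s≤s ()) _
  ∈-allEdges {1F} {suc (suc j)} _ _ = there (∈ₗ.∈-++⁺ˡ (∈ₗ.∈-map⁺ _ (∈ₗ.∈-allFin j)))
  ∈-allEdges {2F} {1F} (s≤s ()) _
  ∈-allEdges {2F} {2F} (s≤s (s≤s ())) _
  ∈-allEdges {2F} {outer (suc j)} _ _ =
    there (∈ₗ.∈-++⁺ʳ edgesFrom₁ (∈ₗ.∈-++⁺ˡ (∈ₗ.∈-map⁺ _ (∈ₗ.∈-allFin j))))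
  ∈-allEdges {outer i} {1F} (s≤s ()) _
  ∈-allEdges {outer i} {2F} (s≤s (s≤s ())) _
  ∈-allEdges {outer i} {outer j} (s≤s (s≤s (s≤s i<j))) _ =
    there (∈ₗ.∈-++⁺ʳ edgesFrom₁ (∈ₗ.∈-++⁺ʳ edgesFrom₂ (∈ₗ.∈-map⁺ _ (∈-increasingPairs i<j))))

  length-allEdges : length allEdges ≡ 1 + ((3 + k) + ((1 + k) + (2 + k) C 2))
  length-allEdges = cong suc (begin
    length (edgesFrom₁ ++ edgesFrom₂ ++ outerEdges)
      ≡⟨ List.length-++ edgesFrom₁ ⟩
    length edgesFrom₁ + length (edgesFrom₂ ++ outerEdges)
      ≡⟨ cong₂ _+_ length-edgesFrom₁ (List.length-++ edgesFrom₂) ⟩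
    (3 + k) + (length edgesFrom₂ + length outerEdges)
      ≡⟨ cong ((3 + k) +_) (cong₂ _+_ length-edgesFrom₂
           (trans (List.length-map _ (increasingPairs (2 + k))) (length-increasingPairs (2 + k)))) ⟩
    (3 + k) + ((1 + k) + (2 + k) C 2) ∎)
    where
    open ≡-Reasoning
    length-edgesFrom₁ : length edgesFrom₁ ≡ 3 + k
    length-edgesFrom₁ = length-map-allFin _
    length-edgesFrom₂ : length edgesFrom₂ ≡ 1 + k
    length-edgesFrom₂ = length-map-allFin _

  nC2∸n+1 : (5 + k) C 2 ∸ (5 + k) + 1 ≡ 1 + ((3 + k) + ((1 + k) + (2 + k) C 2))
  nC2∸n+1 = begin
    (5 + k) C 2 ∸ (5 + k) + 1
      ≡⟨ cong (λ x → x ∸ (5 + k) + 1) (trans ([1+n]C2≡n+nC2 (4 + k))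
           (cong ((4 + k) +_) (trans ([1+n]C2≡n+nC2 (3 + k))
             (cong ((3 + k) +_) ([1+n]C2≡n+nC2 (2 + k)))))) ⟩
    (4 + k) + ((3 + k) + ((2 + k) + c)) ∸ (5 + k) + 1
      -- Three Pascal steps have produced `4 + k`, `3 + k` and `2 + k`. Moving a unit from the last
      -- to the first exhibits a summand `5 + k`, which the truncated subtraction cancels exactly.
      ≡⟨ cong (λ x → x ∸ (5 + k) + 1) (rearrange k c) ⟩
    (5 + k) + ((3 + k) + ((1 + k) + c)) ∸ (5 + k) + 1
      ≡⟨ cong (_+ 1) (ℕ.m+n∸m≡n (5 + k) _) ⟩
    (3 + k) + ((1 + k) + c) + 1
      ≡⟨ ℕ.+-comm _ 1 ⟩
    1 + ((3 + k) + ((1 + k) + c)) ∎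
    where
    open ≡-Reasoning
    c = (2 + k) C 2
    rearrange : ∀ k c → (4 + k) + ((3 + k) + ((2 + k) + c)) ≡ (5 + k) + ((3 + k) + ((1 + k) + c))
    rearrange = solve-∀

  size≤ : size G ≤ (5 + k) C 2 ∸ (5 + k) + 1
  size≤ = ℕ.≤-trans (size≤length G allEdges ∈-allEdges)
            (ℕ.≤-reflexive (trans length-allEdges (sym nC2∸n+1)))

theorem2p7 : (n : ℕ) → 3 ≤ n → 4 ≤ n ∸ 1 →
    ∃[ m ] t n 3 4 m × m ≤ (n C 2) ∸ n + 1
-- `4 ≤ n ∸ 1` forces `n = 5 + k`, which leaves at least two outer vertices.
theorem2p7 (suc (suc (suc (suc (suc k))))) _ _ =
  let m , tm , m≤size = t-exists {5 + k} {3} {4}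
        (G , connected , refl , 4 , ℕ.≤-refl , χ , coloured)
  in m , tm , ℕ.≤-trans m≤size size≤
  where open Construction k
theorem2p7 (suc (suc (suc (suc zero)))) _ (s≤s (s≤s (s≤s ())))
theorem2p7 (suc (suc (suc zero))) _ (s≤s (s≤s ()))
theorem2p7 (suc (suc zero)) _ (s≤s ())
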